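{- Let $(A, \_[\_/\_])$ be a renset satisfying Finite Support, and let $\_[\_\wedge\_] : A \to \mathsf{Var} \to \mathsf{Var} \to A$ be the swapping operator defined from renaming by $$a[x_1 \wedge x_2] = a[y/x_1][x_1/x_2][x_2/y],$$ where $y$ is any variable with $y \notin \{x_1,x_2\}$ and $y \mathrel{\#} a$. Then $(A, \_[\_\wedge\_])$ is a nominal set. Moreover, $(A, \_[\_/\_])$ and $(A, \_[\_\wedge\_])$ have the same notion of freshness: for all $x \in \mathsf{Var}$ and $a \in A$, $x$ is fresh for $a$ in the sense defined from renaming if and only if $x$ is fresh for $a$ in the sense defined from swapping.
   Context: $\mathsf{Var}$ is a fixed countably infinite set (of variables). A renaming-enriched set (renset) is a pair $(A, \_[\_/\_])$ where $A$ is a set and $\_[\_/\_] : A \to \mathsf{Var} \to \mathsf{Var} \to A$ is an operator (renaming) such that for all $x, x_1, x_2, x_3, y, y_1, y_2 \in \mathsf{Var}$ and $a \in A$: - Identity: $a[x/x] = a$; - Idempotence: if $x_1 \neq y$ then $a[x_1/y][x_2/y] = a[x_1/y]$; - Chaining: if $y \neq x_2$ then $a[y/x_2][x_2/x_1][x_3/x_2] = a[y/x_2][x_3/x_1]$; - Commutativity: if $x_2 \neq y_1$, $y_1 \neq x_1$ and $x_1 \neq y_2$ then $a[x_2/x_1][y_2/y_1] = a[y_2/y_1][x_2/x_1]$. Freshness defined from renaming: $x \mathrel{\#} a$ means that one of the following conditions, which are equivalent in any renset, holds: the set $\{y \in \mathsf{Var} \mid a[y/x] \neq a\}$ is finite;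 $a[y/x] = a$ for all $y \in \mathsf{Var}$; $a[y/x] = a$ for some $y \in \mathsf{Var} \setminus \{x\}$. A renset satisfies Finite Support if for all $a \in A$ the set $\{x \in \mathsf{Var} \mid \neg\, x \mathrel{\#} a\}$ is finite. (In a renset satisfying Finite Support, a variable $y$ as in the definition of swapping exists and the result does not depend on its choice.) A pre-nominal set is a pair $(A, \_[\_\wedge\_])$ where $A$ is a set and $\_[\_\wedge\_] : A \to \mathsf{Var} \to \mathsf{Var} \to A$ (swapping) satisfies, for all $a\in A$ and $x,x_1,x_2,y_1,y_2 \in \mathsf{Var}$: Identity $a[x\wedge x] = a$; Involution $a[x_1\wedge x_2][x_1\wedge x_2] = a$; Compositionality $a[x_1\wedge x_2][y_1\wedge y_2] = a[y_1\wedge y_2][(x_1[y_1\wedge y_2])\wedge(x_2[y_1\wedge y_2])]$, where for variables $x[y_1 \wedge y_2]$ is $y_2$ if $x=y_1$, $y_1$ if $x = y_2$, and $x$ otherwise. An element $a$ is supported by $X \subseteq \mathsf{Var}$ if $a[x\wedge y] = a$ for all $x,y \in \mathsf{Var}\setminus X$; it is finitely supported if it is supported by some finite $X \subseteq \mathsf{Var}$. A nominal set is a pre-nominal set all of whose elements are finitely supported. In a nominal set each $a$ has a smallest supporting set $\mathsf{supp}\,a$, and $x$ is fresh for $a$ (freshness defined from swapping) if $x \notin \mathsf{supp}\,a$; equivalently, if the set $\{y \mid a[y\wedge x] \neq a\}$ is finite. -}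

module Defs where

open import Axiom.ExcludedMiddle using (ExcludedMiddle)
open import Data.Bool.Base using (if_then_else_)
open import Data.List.Base using (List; []; _∷_; map)
open import Data.List.Extrema.Nat using (max; xs≤max)
open import Data.List.Membership.Propositional using () renaming (_∈_ to _∈ᴸ_)
open import Data.List.Membership.Propositional.Properties using (∈-map⁺)
open import Data.List.Relation.Unary.All using (lookup)
open import Data.List.Relation.Unary.Any using (here; there)
open import Data.Nat.Base using (ℕ; suc)
open import Data.Nat.Properties using (1+n≰n) renaming (_≟_ to _≟ℕ_)
open import Data.Product.Base using (∃; _×_; _,_)
open import Function.Base using (_∘_)
open import Function.Bundles using (_↔_; Inverse)
open import Function.Properties.Inverse using (↔⇒↣)
open import Level using (Level; 0ℓ; _⊔_) renaming (suc to lsuc)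
open import Relation.Binary.Definitions using (DecidableEquality)
open import Relation.Binary.PropositionalEquality using (_≡_; _≢_; refl; subst)
open import Relation.Nullary.Decidable using (does; via-injection; decidable-stable)
open import Relation.Nullary.Negation using (¬_)
open import Relation.Unary using (Pred; _∈_; _∉_; _⊆_)

-- The finiteness conditions below are the usual ones, phrased with negated
-- equations (e.g. "{ y ∣ a [ y / x ] ≢ a } is finite"), and are meant to be
-- read classically.

module WithVariables (Var : Set) (Var↔ℕ : Var ↔ ℕ) where

  _≟_ : DecidableEquality Var
  _≟_ = via-injection (↔⇒↣ Var↔ℕ) _≟ℕ_

  Finite : ∀ {ℓ} → Pred Var ℓ → Set ℓ
  Finite P = ∃ λ (xs : List Var) → P ⊆ (_∈ᴸ xs)

  ----------------------------------------------------------------------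
  -- Rensets

  record Renset (a : Level) : Set (lsuc a) where
    field
      Carrier : Set a
      _[_/_]  : Carrier → Var → Var → Carrier

      identity      : ∀ a x → a [ x / x ] ≡ a
      idempotence   : ∀ a x₁ x₂ y → x₁ ≢ y →
                      a [ x₁ / y ] [ x₂ / y ] ≡ a [ x₁ / y ]
      chaining      : ∀ a x₁ x₂ x₃ y → y ≢ x₂ →
                      a [ y / x₂ ] [ x₂ / x₁ ] [ x₃ / x₂ ] ≡
                      a [ y / x₂ ] [ x₃ / x₁ ]
      commutativity : ∀ a x₁ x₂ y₁ y₂ → x₂ ≢ y₁ → y₁ ≢ x₁ → x₁ ≢ y₂ →
                      a [ x₂ / x₁ ] [ y₂ / y₁ ] ≡ a [ y₂ / y₁ ] [ x₂ / x₁ ]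

    infix 4 _#_

    _#_ : Var → Carrier → Set a
    x # a = Finite (λ y → a [ y / x ] ≢ a)

    FiniteSupport : Set a
    FiniteSupport = ∀ a → Finite (λ x → ¬ x # a)

    -- The auxiliary variable y may be chosen arbitrarily, and differently for
    -- each a, x₁ and x₂.
    DefinesSwapping : (Carrier → Var → Var → Carrier) → Set a
    DefinesSwapping _[_∧_] =
      ∀ a x₁ x₂ → ∃ λ y → y ≢ x₁ × y ≢ x₂ × y # a ×
        a [ x₁ ∧ x₂ ] ≡ a [ y / x₁ ] [ x₁ / x₂ ] [ x₂ / y ]

  ----------------------------------------------------------------------
  -- Nominal sets

  _[_∧_]ᵛ : Var → Var → Var → Var
  x [ y₁ ∧ y₂ ]ᵛ =
    if does (x ≟ y₁) then y₂ else if does (x ≟ y₂) then y₁ else x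

  module _ {a} {A : Set a} (_[_∧_] : A → Var → Var → A) where

    record IsPreNominal : Set a where
      field
        identity         : ∀ a x → a [ x ∧ x ] ≡ a
        involution       : ∀ a x₁ x₂ → a [ x₁ ∧ x₂ ] [ x₁ ∧ x₂ ] ≡ a
        compositionality : ∀ a x₁ x₂ y₁ y₂ →
          a [ x₁ ∧ x₂ ] [ y₁ ∧ y₂ ] ≡
          a [ y₁ ∧ y₂ ] [ x₁ [ y₁ ∧ y₂ ]ᵛ ∧ x₂ [ y₁ ∧ y₂ ]ᵛ ]

    Supports : Pred Var 0ℓ → A → Set a
    Supports X a = ∀ x y → x ∉ X → y ∉ X → a [ x ∧ y ] ≡ a

    FinitelySupported : A → Set (lsuc 0ℓ ⊔ a)
    FinitelySupported a = ∃ λ X → Finite X × Supports X a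

    record IsNominal : Set (lsuc 0ℓ ⊔ a) where
      field
        isPreNominal      : IsPreNominal
        finitelySupported : ∀ a → FinitelySupported a

    -- Smallest among the finite supporting sets: every complement of a
    -- singleton supports every element, so among all supporting sets there is
    -- in general no smallest one.
    IsSupp : Pred Var 0ℓ → A → Set (lsuc 0ℓ ⊔ a)
    IsSupp X a = Finite X × Supports X a ×
                 (∀ Y → Finite Y → Supports Y a → X ⊆ Y)

    -- x ∉ supp a, with supp a given by definite description.
    FreshBySwapping : Var → A → Set (lsuc 0ℓ ⊔ a)
    FreshBySwapping x a = ∃ λ X → IsSupp X a × x ∉ X

  ----------------------------------------------------------------------
  -- Under Finite Support, DefinesSwapping is inhabited.

  outside : (xs : List Var) → ∃ λ y → ¬ (y ∈ᴸ xs)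
  outside xs = from n , λ y∈xs →
    1+n≰n (lookup (xs≤max 0 ns)
      (subst (_∈ᴸ ns) (strictlyInverseˡ n) (∈-map⁺ to y∈xs)))
    where
    open Inverse Var↔ℕ
    ns = map to xs
    n  = suc (max 0 ns)

  module _ {a} (em : ExcludedMiddle a) (R : Renset a) where
    open Renset R

    swapping : FiniteSupport → ∃ DefinesSwapping
    swapping fs = (λ a x₁ x₂ → let (y , _) = pick a x₁ x₂ in
                     a [ y / x₁ ] [ x₁ / x₂ ] [ x₂ / y ]) ,
                  (λ a x₁ x₂ → let (y , y≢x₁ , y≢x₂ , y#a) = pick a x₁ x₂ in
                     y , y≢x₁ , y≢x₂ , y#a , refl)
      where
      pick : ∀ a x₁ x₂ → ∃ λ y → y ≢ x₁ × y ≢ x₂ × y # a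
      pick a x₁ x₂ =
        let (xs , unfresh) = fs a
            (y , y∉)       = outside (x₁ ∷ x₂ ∷ xs)
        in y , y∉ ∘ here , y∉ ∘ there ∘ here ,
           decidable-stable em (y∉ ∘ there ∘ there ∘ unfresh)

{-# OPTIONS --safe #-}

-- Call x inert in a if every renaming of x leaves a unchanged; this is
-- equivalent to x # a.  Renaming through a variable z inert in a is invisible:
-- a [ z / x ] [ y / z ] = a [ y / x ].  It follows that the swapping does not
-- depend on the auxiliary variable, and that a [ x ∧ z ] = a [ z / x ] whenever
-- z is inert in a.  Every instance of compositionality reduces, by the symmetry
-- of swapping, to a [ x ∧ z ] [ x ∧ y ] = a [ x ∧ y ] [ y ∧ z ] and to the
-- disjoint case; both are proved by moving a swapping past the three renamings
-- in the definition of another one.  As for freshness: if X is finite and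
-- supports a, and x ∉ X, then for z ∉ X inert in a, a = a [ x ∧ z ] = a [ z / x ],
-- so x is inert in a.

module Submission where

open import Defs
open import Axiom.ExcludedMiddle using (ExcludedMiddle)
open import Data.Bool.Base using (if_then_else_)
open import Data.Empty using (⊥-elim)
open import Data.List.Base using (List; []; _∷_; _++_; filter)
open import Data.List.Membership.Propositional using (_∈_; _∉_)
open import Data.List.Membership.Propositional.Properties
  using (∈-++⁺ˡ; ∈-++⁺ʳ; ∈-filter⁺; ∈-filter⁻)
open import Data.List.Relation.Unary.Any using (here; there)
open import Data.Nat.Base using (ℕ)
open import Data.Product.Base using (∃; _×_; _,_; proj₁; proj₂)
open import Function.Base using (id; _∘_)
open import Function.Bundles using (_↔_; _⇔_; mk⇔)
open import Level using (Level; 0ℓ; lift; lower)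
open import Relation.Binary.PropositionalEquality
  using (_≡_; _≢_; refl; sym; trans; cong; subst; ≢-sym; module ≡-Reasoning)
open import Relation.Nullary.Decidable
  using (Dec; does; yes; no; map′; decidable-stable)
open import Relation.Nullary.Negation using (¬_)
open import Relation.Unary using (Pred)

open ≡-Reasoning

private variable
  ℓ : Level

-- Supporting sets are predicates valued in `Set`, while excluded middle is given at the level of
-- the carrier.
lowerEM : ExcludedMiddle ℓ → ExcludedMiddle 0ℓ
lowerEM em = map′ lower lift em

-- Swapping of variables

module VariableSwapping (Var : Set) (Var↔ℕ : Var ↔ ℕ) where
  open WithVariables Var Var↔ℕ

  -- The graph of `_[ y₁ ∧ y₂ ]ᵛ`: indexing by the image lets case matching replace the unfolding of
  -- nested conditionals.
  data SwapView (y₁ y₂ : Var) : Var → Var → Set where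
    left  : SwapView y₁ y₂ y₁ y₂
    right : SwapView y₁ y₂ y₂ y₁
    other : ∀ {x} → x ≢ y₁ → x ≢ y₂ → SwapView y₁ y₂ x x

  swapView : ∀ y₁ y₂ x → SwapView y₁ y₂ x (x [ y₁ ∧ y₂ ]ᵛ)
  swapView y₁ y₂ x = view (x ≟ y₁) (x ≟ y₂)
    where
    view : ∀ {x} (d₁ : Dec (x ≡ y₁)) (d₂ : Dec (x ≡ y₂)) →
           SwapView y₁ y₂ x (if does d₁ then y₂ else if does d₂ then y₁ else x)
    view (yes refl) _          = left
    view (no _)     (yes refl) = right
    view (no x≢y₁)  (no x≢y₂)  = other x≢y₁ x≢y₂

  swapView-identity : ∀ {y x z} → SwapView y y x z → x ≡ z
  swapView-identity left        = refl
  swapView-identity right       = refl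
  swapView-identity (other _ _) = refl

module RensetProperties {ℓ} (em : ExcludedMiddle ℓ) (Var : Set) (Var↔ℕ : Var ↔ ℕ)
  (R : WithVariables.Renset Var Var↔ℕ ℓ) where
  open WithVariables Var Var↔ℕ
  open Renset R
  open VariableSwapping Var Var↔ℕ

  -- Inert variables in a renset

  Inert : Var → Carrier → Set ℓ
  Inert x a = ∀ y → a [ y / x ] ≡ a

  -- Here `a` is itself of the form `a [ y / x ]`, so idempotence absorbs any further renaming of
  -- `x`.
  fixed⇒inert : ∀ {a x y} → y ≢ x → a [ y / x ] ≡ a → Inert x a
  fixed⇒inert {a} {x} {y} y≢x fix z = begin
    a [ z / x ]             ≡⟨ cong (_[ z / x ]) fix ⟨
    a [ y / x ] [ z / x ]   ≡⟨ idempotence a y z x y≢x ⟩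
    a [ y / x ]             ≡⟨ fix ⟩
    a                       ∎

  -- Only finitely many renamings of `x` move `a`, so some `y ≢ x` fixes it.
  #⇒inert : ∀ {a x} → x # a → Inert x a
  #⇒inert {a} {x} (ys , moved) =
    let (y , y∉) = outside (x ∷ ys)
    in fixed⇒inert (y∉ ∘ here) (decidable-stable em (y∉ ∘ there ∘ moved))

  inert⇒# : ∀ {a x} → Inert x a → x # a
  inert⇒# i = [] , λ moved → ⊥-elim (moved (i _))

  inert-renamed : ∀ a {x y} → y ≢ x → Inert x (a [ y / x ])
  inert-renamed a y≢x z = idempotence a _ z _ y≢x

  inert-[/] : ∀ {a x y z} → z ≢ y → Inert z a → Inert z (a [ y / x ])
  inert-[/] {a} {x} {y} {z} z≢y i with z ≟ x
  ... | yes refl = inert-renamed a (≢-sym z≢y)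
  ... | no z≢x   =
    -- A single test renaming of `z` suffices; `w ≢ x` lets it commute with `[ y / x ]`, and `w ≢ z`
    -- makes it a valid test.
    let (w , w∉) = outside (x ∷ z ∷ [])
    in fixed⇒inert (w∉ ∘ there ∘ here) (begin
      a [ y / x ] [ w / z ]
        ≡⟨ commutativity a x y z w (≢-sym z≢y) z≢x (≢-sym (w∉ ∘ here)) ⟩
      a [ w / z ] [ y / x ]   ≡⟨ cong (_[ y / x ]) (i w) ⟩
      a [ y / x ]             ∎)

  -- Chaining wants an element of the form `a [ w / z ]`; inertness of `z` puts `a` in that form.
  chain-inert : ∀ {a z} x y → Inert z a → a [ z / x ] [ y / z ] ≡ a [ y / x ]
  chain-inert {a} {z} x y i =
    let (w , w∉) = outside (z ∷ [])
    in subst (λ b → b [ z / x ] [ y / z ] ≡ b [ y / x ]) (i w)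
         (chaining a x z y w (w∉ ∘ here))

  -- Independence of the auxiliary variable

  swapVia : Var → Carrier → Var → Var → Carrier
  swapVia u a x₁ x₂ = a [ u / x₁ ] [ x₁ / x₂ ] [ x₂ / u ]

  -- Reach `v` through `u`, commute `[ v / u ]` past the middle renaming, and merge it with
  -- `[ x₂ / v ]`; `v` is still inert at that point.
  swapVia-independent : ∀ {a x₁ x₂ u v} →
    u ≢ x₁ → u ≢ x₂ → Inert u a → v ≢ x₁ → v ≢ x₂ → Inert v a →
    swapVia u a x₁ x₂ ≡ swapVia v a x₁ x₂
  swapVia-independent {a} {x₁} {x₂} {u} {v} u≢x₁ u≢x₂ iu v≢x₁ v≢x₂ iv with v ≟ u
  ... | yes refl = refl
  ... | no v≢u   = sym (begin
    a [ v / x₁ ] [ x₁ / x₂ ] [ x₂ / v ]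
      ≡⟨ cong (λ b → b [ x₁ / x₂ ] [ x₂ / v ]) (chain-inert x₁ v iu) ⟨
    a [ u / x₁ ] [ v / u ] [ x₁ / x₂ ] [ x₂ / v ]
      ≡⟨ cong (_[ x₂ / v ])
           (commutativity (a [ u / x₁ ]) u v x₂ x₁ v≢x₂ (≢-sym u≢x₂) u≢x₁) ⟩
    a [ u / x₁ ] [ x₁ / x₂ ] [ v / u ] [ x₂ / v ]
      ≡⟨ chain-inert u x₂ (inert-[/] v≢x₁ (inert-[/] v≢u iv)) ⟩
    a [ u / x₁ ] [ x₁ / x₂ ] [ x₂ / u ] ∎)

  -- Identity, symmetry and involution of swapping

  module Swapping (fs : FiniteSupport) (_[_∧_] : Carrier → Var → Var → Carrier)
    (defines : DefinesSwapping _[_∧_]) where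

    -- Matching on it with `with` would otherwise normalise the maximum in outside.
    abstract
      inertOutside : ∀ a (xs : List Var) → ∃ λ u → u ∉ xs × Inert u a
      inertOutside a xs =
        let (ys , unfresh) = fs a
            (u , u∉)       = outside (xs ++ ys)
        in u , u∉ ∘ ∈-++⁺ˡ ,
           #⇒inert (decidable-stable em (u∉ ∘ ∈-++⁺ʳ xs ∘ unfresh))

    -- Later proofs may thus choose their own auxiliary variable, away from everything else in play.
    swap-via : ∀ {a x₁ x₂ u} → u ≢ x₁ → u ≢ x₂ → Inert u a →
               a [ x₁ ∧ x₂ ] ≡ swapVia u a x₁ x₂
    swap-via {a} {x₁} {x₂} u≢x₁ u≢x₂ iu =
      let (y , y≢x₁ , y≢x₂ , y#a , eq) = defines a x₁ x₂
      in trans eq (swapVia-independent y≢x₁ y≢x₂ (#⇒inert y#a) u≢x₁ u≢x₂ iu)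

    swap-identity : ∀ a x → a [ x ∧ x ] ≡ a
    swap-identity a x with (u , u∉ , iu) ← inertOutside a (x ∷ []) = begin
      a [ x ∧ x ]                         ≡⟨ swap-via (u∉ ∘ here) (u∉ ∘ here) iu ⟩
      a [ u / x ] [ x / x ] [ x / u ]     ≡⟨ cong (_[ x / u ]) (identity _ x) ⟩
      a [ u / x ] [ x / u ]               ≡⟨ chain-inert x x iu ⟩
      a [ x / x ]                         ≡⟨ identity a x ⟩
      a                                   ∎

    -- Two auxiliary variables make the roles of x₁ and x₂ interchangeable.
    swap-via₂ : ∀ {a x₁ x₂ u v} → u ≢ x₁ → u ≢ x₂ → v ≢ x₂ → v ≢ u →
                Inert u a → Inert v a →
                a [ x₁ ∧ x₂ ] ≡ a [ u / x₁ ] [ v / x₂ ] [ x₁ / v ] [ x₂ / u ]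
    swap-via₂ {a} {x₁} {x₂} {u} {v} u≢x₁ u≢x₂ v≢x₂ v≢u iu iv = begin
      a [ x₁ ∧ x₂ ]
        ≡⟨ swap-via u≢x₁ u≢x₂ iu ⟩
      a [ u / x₁ ] [ x₁ / x₂ ] [ x₂ / u ]
        ≡⟨ cong (_[ x₂ / u ]) (chain-inert x₂ x₁ (inert-[/] v≢u iv)) ⟨
      a [ u / x₁ ] [ v / x₂ ] [ x₁ / v ] [ x₂ / u ] ∎

    -- Moving out to `u` and `v` and moving back each consist of two commuting renamings.
    swap-sym : ∀ a x₁ x₂ → a [ x₁ ∧ x₂ ] ≡ a [ x₂ ∧ x₁ ]
    swap-sym a x₁ x₂ with x₁ ≟ x₂
    ... | yes refl = refl
    ... | no x₁≢x₂
      with (u , u∉ , iu) ← inertOutside a (x₁ ∷ x₂ ∷ [])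
      with (v , v∉ , iv) ← inertOutside a (x₁ ∷ x₂ ∷ u ∷ []) =
      let u≢x₁ = u∉ ∘ here
          u≢x₂ = u∉ ∘ there ∘ here
          v≢x₁ = v∉ ∘ here
          v≢x₂ = v∉ ∘ there ∘ here
          v≢u  = v∉ ∘ there ∘ there ∘ here
      in begin
      a [ x₁ ∧ x₂ ]
        ≡⟨ swap-via₂ u≢x₁ u≢x₂ v≢x₂ v≢u iu iv ⟩
      a [ u / x₁ ] [ v / x₂ ] [ x₁ / v ] [ x₂ / u ]
        ≡⟨ cong (λ b → b [ x₁ / v ] [ x₂ / u ])
             (commutativity a x₁ u x₂ v u≢x₂ (≢-sym x₁≢x₂) (≢-sym v≢x₁)) ⟩
      a [ v / x₂ ] [ u / x₁ ] [ x₁ / v ] [ x₂ / u ]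
        ≡⟨ commutativity (a [ v / x₂ ] [ u / x₁ ]) v x₁ u x₂
             (≢-sym u≢x₁) (≢-sym v≢u) v≢x₂ ⟩
      a [ v / x₂ ] [ u / x₁ ] [ x₂ / u ] [ x₁ / v ]
        ≡⟨ swap-via₂ v≢x₂ v≢x₁ u≢x₁ (≢-sym v≢u) iv iu ⟨
      a [ x₂ ∧ x₁ ] ∎

    -- With its arguments exchanged and the same auxiliary `u`, the second swapping undoes the three
    -- renamings of the first in reverse order.
    swap-involution : ∀ a x₁ x₂ → a [ x₁ ∧ x₂ ] [ x₁ ∧ x₂ ] ≡ a
    swap-involution a x₁ x₂ with x₁ ≟ x₂
    ... | yes refl = trans (swap-identity _ x₁) (swap-identity a x₁)
    ... | no x₁≢x₂
      with (u , u∉ , iu) ← inertOutside a (x₁ ∷ x₂ ∷ []) =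
      let u≢x₁ = u∉ ∘ here
          u≢x₂ = u∉ ∘ there ∘ here
          b    = a [ u / x₁ ]
          c    = b [ x₁ / x₂ ]
      in begin
      a [ x₁ ∧ x₂ ] [ x₁ ∧ x₂ ]
        ≡⟨ swap-sym _ x₁ x₂ ⟩
      a [ x₁ ∧ x₂ ] [ x₂ ∧ x₁ ]
        ≡⟨ cong (_[ x₂ ∧ x₁ ]) (swap-via u≢x₁ u≢x₂ iu) ⟩
      c [ x₂ / u ] [ x₂ ∧ x₁ ]
        ≡⟨ swap-via u≢x₂ u≢x₁ (inert-renamed c (≢-sym u≢x₂)) ⟩
      c [ x₂ / u ] [ u / x₂ ] [ x₂ / x₁ ] [ x₁ / u ]
        ≡⟨ cong (λ d → d [ x₂ / x₁ ] [ x₁ / u ])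
             (trans (chain-inert u u (inert-renamed b x₁≢x₂)) (identity c u)) ⟩
      b [ x₁ / x₂ ] [ x₂ / x₁ ] [ x₁ / u ]
        ≡⟨ cong (_[ x₁ / u ])
             (trans (chain-inert x₂ x₂ (inert-renamed a u≢x₁)) (identity b x₂)) ⟩
      a [ u / x₁ ] [ x₁ / u ]
        ≡⟨ trans (chain-inert x₁ x₁ iu) (identity a x₁) ⟩
      a ∎

    -- Interaction of renaming and swapping

    swap-inertʳ : ∀ {a z} x → Inert z a → a [ x ∧ z ] ≡ a [ z / x ]
    swap-inertʳ {a} {z} x i with (u , u∉ , iu) ← inertOutside a (x ∷ z ∷ []) =
      let u≢z = u∉ ∘ there ∘ here
      in begin
      a [ x ∧ z ]                       ≡⟨ swap-via (u∉ ∘ here) u≢z iu ⟩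
      a [ u / x ] [ x / z ] [ z / u ]
        ≡⟨ cong (_[ z / u ]) (inert-[/] (≢-sym u≢z) i x) ⟩
      a [ u / x ] [ z / u ]             ≡⟨ chain-inert x z iu ⟩
      a [ z / x ]                       ∎

    swap-inertˡ : ∀ {a x} z → Inert x a → a [ x ∧ z ] ≡ a [ x / z ]
    swap-inertˡ {a} {x} z i = trans (swap-sym a x z) (swap-inertʳ z i)

    -- With `u` itself as auxiliary variable, the last renaming removes it.
    inert-swap : ∀ {a u x₁ x₂} → u ≢ x₁ → u ≢ x₂ → Inert u a → Inert u (a [ x₁ ∧ x₂ ])
    inert-swap {a} {u} {x₁} {x₂} u≢x₁ u≢x₂ iu =
      subst (Inert u) (sym (swap-via u≢x₁ u≢x₂ iu))
        (inert-renamed (a [ u / x₁ ] [ x₁ / x₂ ]) (≢-sym u≢x₂))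

    rename-swap-disjoint : ∀ a {p q y₁ y₂} → p ≢ y₁ → p ≢ y₂ → q ≢ y₁ → q ≢ y₂ →
      a [ p / q ] [ y₁ ∧ y₂ ] ≡ a [ y₁ ∧ y₂ ] [ p / q ]
    rename-swap-disjoint a {p} {q} {y₁} {y₂} p≢y₁ p≢y₂ q≢y₁ q≢y₂
      with (u , u∉ , iu) ← inertOutside a (y₁ ∷ y₂ ∷ p ∷ q ∷ []) =
      let u≢y₁ = u∉ ∘ here
          u≢y₂ = u∉ ∘ there ∘ here
          u≢p  = u∉ ∘ there ∘ there ∘ here
          u≢q  = u∉ ∘ there ∘ there ∘ there ∘ here
      in begin
      a [ p / q ] [ y₁ ∧ y₂ ]
        ≡⟨ swap-via u≢y₁ u≢y₂ (inert-[/] u≢p iu) ⟩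
      a [ p / q ] [ u / y₁ ] [ y₁ / y₂ ] [ y₂ / u ]
        ≡⟨ cong (λ b → b [ y₁ / y₂ ] [ y₂ / u ])
             (commutativity a q p y₁ u p≢y₁ (≢-sym q≢y₁) (≢-sym u≢q)) ⟩
      a [ u / y₁ ] [ p / q ] [ y₁ / y₂ ] [ y₂ / u ]
        ≡⟨ cong (_[ y₂ / u ]) (commutativity _ q p y₂ y₁ p≢y₂ (≢-sym q≢y₂) q≢y₁) ⟩
      a [ u / y₁ ] [ y₁ / y₂ ] [ p / q ] [ y₂ / u ]
        ≡⟨ commutativity _ q p u y₂ (≢-sym u≢p) u≢q q≢y₂ ⟩
      a [ u / y₁ ] [ y₁ / y₂ ] [ y₂ / u ] [ p / q ]
        ≡⟨ cong (_[ p / q ]) (swap-via u≢y₁ u≢y₂ iu) ⟨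
      a [ y₁ ∧ y₂ ] [ p / q ] ∎

    -- On the left `x` has become inert, so the swapping is just `[ x / y ]`. On the right `y` is
    -- inert before `[ y / u ]`, so the last two renamings merge into `[ p / u ]`, which commutes
    -- with `[ x / y ]`.
    rename-swap-source : ∀ a {p x y} → p ≢ x → p ≢ y → x ≢ y →
      a [ p / x ] [ x ∧ y ] ≡ a [ x ∧ y ] [ p / y ]
    rename-swap-source a {p} {x} {y} p≢x p≢y x≢y
      with (u , u∉ , iu) ← inertOutside a (x ∷ y ∷ []) =
      let u≢x = u∉ ∘ here
          u≢y = u∉ ∘ there ∘ here
      in begin
      a [ p / x ] [ x ∧ y ]
        ≡⟨ swap-inertˡ y (inert-renamed a p≢x) ⟩
      a [ p / x ] [ x / y ]
        ≡⟨ cong (_[ x / y ]) (chain-inert x p iu) ⟨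
      a [ u / x ] [ p / u ] [ x / y ]
        ≡⟨ commutativity _ u p y x p≢y (≢-sym u≢y) u≢x ⟩
      a [ u / x ] [ x / y ] [ p / u ]
        ≡⟨ chain-inert u p (inert-renamed (a [ u / x ]) x≢y) ⟨
      a [ u / x ] [ x / y ] [ y / u ] [ p / y ]
        ≡⟨ cong (_[ p / y ]) (swap-via u≢x u≢y iu) ⟨
      a [ x ∧ y ] [ p / y ] ∎

    -- Inertness of x keeps the renaming injective: q is not merged with x.
    rename-swap-target : ∀ {a q x y} → q ≢ x → q ≢ y → x ≢ y → Inert x a →
      a [ x / q ] [ x ∧ y ] ≡ a [ x ∧ y ] [ y / q ]
    rename-swap-target {a} {q} {x} {y} q≢x q≢y x≢y i
      with (u , u∉ , iu) ← inertOutside a (x ∷ y ∷ q ∷ []) =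
      let u≢x = u∉ ∘ here
          u≢y = u∉ ∘ there ∘ here
          u≢q = u∉ ∘ there ∘ there ∘ here
      in begin
      a [ x / q ] [ x ∧ y ]
        -- In this orientation the middle renaming is `[ y / x ]`, which can absorb `[ x / q ]`.
        ≡⟨ swap-sym _ x y ⟩
      a [ x / q ] [ y ∧ x ]
        ≡⟨ swap-via u≢y u≢x (inert-[/] u≢x iu) ⟩
      a [ x / q ] [ u / y ] [ y / x ] [ x / u ]
        ≡⟨ cong (λ b → b [ y / x ] [ x / u ])
             (commutativity a q x y u x≢y (≢-sym q≢y) (≢-sym u≢q)) ⟩
      a [ u / y ] [ x / q ] [ y / x ] [ x / u ]
        ≡⟨ cong (_[ x / u ]) (chain-inert q y (inert-[/] (≢-sym u≢x) i)) ⟩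
      a [ u / y ] [ y / q ] [ x / u ]
        ≡⟨ commutativity _ q y u x (≢-sym u≢y) u≢q q≢x ⟩
      a [ u / y ] [ x / u ] [ y / q ]
        ≡⟨ cong (_[ y / q ]) (chain-inert y x iu) ⟩
      a [ x / y ] [ y / q ]
        ≡⟨ cong (_[ y / q ]) (swap-inertˡ y i) ⟨
      a [ x ∧ y ] [ y / q ] ∎

    -- Compositionality

    swap-swap-disjoint : ∀ a {x₁ x₂ y₁ y₂} →
      x₁ ≢ y₁ → x₁ ≢ y₂ → x₂ ≢ y₁ → x₂ ≢ y₂ →
      a [ x₁ ∧ x₂ ] [ y₁ ∧ y₂ ] ≡ a [ y₁ ∧ y₂ ] [ x₁ ∧ x₂ ]
    swap-swap-disjoint a {x₁} {x₂} {y₁} {y₂} x₁≢y₁ x₁≢y₂ x₂≢y₁ x₂≢y₂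
      with (u , u∉ , iu) ← inertOutside a (x₁ ∷ x₂ ∷ y₁ ∷ y₂ ∷ []) =
      let u≢x₁ = u∉ ∘ here
          u≢x₂ = u∉ ∘ there ∘ here
          u≢y₁ = u∉ ∘ there ∘ there ∘ here
          u≢y₂ = u∉ ∘ there ∘ there ∘ there ∘ here
      in begin
      a [ x₁ ∧ x₂ ] [ y₁ ∧ y₂ ]
        ≡⟨ cong (_[ y₁ ∧ y₂ ]) (swap-via u≢x₁ u≢x₂ iu) ⟩
      a [ u / x₁ ] [ x₁ / x₂ ] [ x₂ / u ] [ y₁ ∧ y₂ ]
        ≡⟨ rename-swap-disjoint _ x₂≢y₁ x₂≢y₂ u≢y₁ u≢y₂ ⟩
      a [ u / x₁ ] [ x₁ / x₂ ] [ y₁ ∧ y₂ ] [ x₂ / u ]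
        ≡⟨ cong (_[ x₂ / u ]) (rename-swap-disjoint _ x₁≢y₁ x₁≢y₂ x₂≢y₁ x₂≢y₂) ⟩
      a [ u / x₁ ] [ y₁ ∧ y₂ ] [ x₁ / x₂ ] [ x₂ / u ]
        ≡⟨ cong (λ b → b [ x₁ / x₂ ] [ x₂ / u ])
             (rename-swap-disjoint a u≢y₁ u≢y₂ x₁≢y₁ x₁≢y₂) ⟩
      a [ y₁ ∧ y₂ ] [ u / x₁ ] [ x₁ / x₂ ] [ x₂ / u ]
        ≡⟨ swap-via u≢x₁ u≢x₂ (inert-swap u≢y₁ u≢y₂ iu) ⟨
      a [ y₁ ∧ y₂ ] [ x₁ ∧ x₂ ] ∎

    swap-swap-overlap : ∀ a {x y z} → x ≢ y → z ≢ x → z ≢ y →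
      a [ x ∧ z ] [ x ∧ y ] ≡ a [ x ∧ y ] [ y ∧ z ]
    swap-swap-overlap a {x} {y} {z} x≢y z≢x z≢y
      with (u , u∉ , iu) ← inertOutside a (x ∷ y ∷ z ∷ []) =
      let u≢x = u∉ ∘ here
          u≢y = u∉ ∘ there ∘ here
          u≢z = u∉ ∘ there ∘ there ∘ here
      in begin
      a [ x ∧ z ] [ x ∧ y ]
        ≡⟨ cong (_[ x ∧ y ]) (swap-via u≢x u≢z iu) ⟩
      a [ u / x ] [ x / z ] [ z / u ] [ x ∧ y ]
        ≡⟨ rename-swap-disjoint _ z≢x z≢y u≢x u≢y ⟩
      a [ u / x ] [ x / z ] [ x ∧ y ] [ z / u ]
        -- The first renaming has already made `x` inert, as `rename-swap-target` demands.
        ≡⟨ cong (_[ z / u ]) (rename-swap-target z≢x z≢y x≢y (inert-renamed a u≢x)) ⟩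
      a [ u / x ] [ x ∧ y ] [ y / z ] [ z / u ]
        ≡⟨ cong (λ b → b [ y / z ] [ z / u ]) (rename-swap-source a u≢x u≢y x≢y) ⟩
      a [ x ∧ y ] [ u / y ] [ y / z ] [ z / u ]
        ≡⟨ swap-via u≢y u≢z (inert-swap u≢x u≢y iu) ⟨
      a [ x ∧ y ] [ y ∧ z ] ∎

    -- Together with `swap-sym`, this settles every case in which one of the two variables is fixed;
    -- the rest need only identity and symmetry.
    swap-conjugate-other : ∀ a {x₁ x₂ y₁ y₂ z₁} → y₁ ≢ y₂ →
      SwapView y₁ y₂ x₁ z₁ → x₂ ≢ y₁ → x₂ ≢ y₂ →
      a [ x₁ ∧ x₂ ] [ y₁ ∧ y₂ ] ≡ a [ y₁ ∧ y₂ ] [ z₁ ∧ x₂ ]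
    swap-conjugate-other a y₁≢y₂ left x₂≢y₁ x₂≢y₂ =
      swap-swap-overlap a y₁≢y₂ x₂≢y₁ x₂≢y₂
    swap-conjugate-other a {x₂ = x₂} {y₁} {y₂} y₁≢y₂ right x₂≢y₁ x₂≢y₂ = begin
      a [ y₂ ∧ x₂ ] [ y₁ ∧ y₂ ]   ≡⟨ swap-sym _ y₁ y₂ ⟩
      a [ y₂ ∧ x₂ ] [ y₂ ∧ y₁ ]
        ≡⟨ swap-swap-overlap a (≢-sym y₁≢y₂) x₂≢y₂ x₂≢y₁ ⟩
      a [ y₂ ∧ y₁ ] [ y₁ ∧ x₂ ]   ≡⟨ cong (_[ y₁ ∧ x₂ ]) (swap-sym a y₂ y₁) ⟩
      a [ y₁ ∧ y₂ ] [ y₁ ∧ x₂ ]   ∎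
    swap-conjugate-other a y₁≢y₂ (other x₁≢y₁ x₁≢y₂) x₂≢y₁ x₂≢y₂ =
      swap-swap-disjoint a x₁≢y₁ x₁≢y₂ x₂≢y₁ x₂≢y₂

    swap-conjugate : ∀ a {x₁ x₂ y₁ y₂ z₁ z₂} → y₁ ≢ y₂ →
      SwapView y₁ y₂ x₁ z₁ → SwapView y₁ y₂ x₂ z₂ →
      a [ x₁ ∧ x₂ ] [ y₁ ∧ y₂ ] ≡ a [ y₁ ∧ y₂ ] [ z₁ ∧ z₂ ]
    swap-conjugate a {y₁ = y₁} {y₂} _ left left =
      trans (cong (_[ y₁ ∧ y₂ ]) (swap-identity a y₁)) (sym (swap-identity _ y₂))
    swap-conjugate a {y₁ = y₁} {y₂} _ right right =
      trans (cong (_[ y₁ ∧ y₂ ]) (swap-identity a y₂)) (sym (swap-identity _ y₁))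
    swap-conjugate a {y₁ = y₁} {y₂} _ left right = swap-sym _ y₁ y₂
    swap-conjugate a {y₁ = y₁} {y₂} _ right left =
      cong (_[ y₁ ∧ y₂ ]) (swap-sym a y₂ y₁)
    swap-conjugate a y₁≢y₂ v₁ (other x₂≢y₁ x₂≢y₂) =
      swap-conjugate-other a y₁≢y₂ v₁ x₂≢y₁ x₂≢y₂
    swap-conjugate a {x₁} {x₂} {y₁} {y₂} {_} {z₂} y₁≢y₂ (other x₁≢y₁ x₁≢y₂) v₂ = begin
      a [ x₁ ∧ x₂ ] [ y₁ ∧ y₂ ]   ≡⟨ cong (_[ y₁ ∧ y₂ ]) (swap-sym a x₁ x₂) ⟩
      a [ x₂ ∧ x₁ ] [ y₁ ∧ y₂ ]
        ≡⟨ swap-conjugate-other a y₁≢y₂ v₂ x₁≢y₁ x₁≢y₂ ⟩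
      a [ y₁ ∧ y₂ ] [ z₂ ∧ x₁ ]   ≡⟨ swap-sym _ z₂ x₁ ⟩
      a [ y₁ ∧ y₂ ] [ x₁ ∧ z₂ ]   ∎

    swap-compositionality : ∀ a x₁ x₂ y₁ y₂ →
      a [ x₁ ∧ x₂ ] [ y₁ ∧ y₂ ] ≡
      a [ y₁ ∧ y₂ ] [ x₁ [ y₁ ∧ y₂ ]ᵛ ∧ x₂ [ y₁ ∧ y₂ ]ᵛ ]
    swap-compositionality a x₁ x₂ y₁ y₂ =
      go (y₁ ≟ y₂) (swapView y₁ y₂ x₁) (swapView y₁ y₂ x₂)
      where
      -- The images are generalised to `z₁` and `z₂` so that matching on `refl` can identify them
      -- with `x₁` and `x₂` when `y₁ ≡ y₂`.
      go : ∀ {z₁ z₂} → Dec (y₁ ≡ y₂) → SwapView y₁ y₂ x₁ z₁ → SwapView y₁ y₂ x₂ z₂ →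
           a [ x₁ ∧ x₂ ] [ y₁ ∧ y₂ ] ≡ a [ y₁ ∧ y₂ ] [ z₁ ∧ z₂ ]
      go (no y₁≢y₂) v₁ v₂ = swap-conjugate a y₁≢y₂ v₁ v₂
      go (yes refl) v₁ v₂ with refl ← swapView-identity v₁ | refl ← swapView-identity v₂ =
        trans (swap-identity _ y₁) (cong (_[ x₁ ∧ x₂ ]) (sym (swap-identity a y₁)))

    isPreNominal : IsPreNominal _[_∧_]
    isPreNominal = record
      { identity         = swap-identity
      ; involution       = swap-involution
      ; compositionality = swap-compositionality
      }

    -- Support and freshness

    -- Inertness of `y` turns the swapping into a renaming of `x`, which is inert as well.
    inert-supports : ∀ {X : Pred Var 0ℓ} {a} → (∀ x → ¬ X x → Inert x a) →
                     Supports _[_∧_] X a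
    inert-supports i x y x∉X y∉X = trans (swap-inertʳ x (i y y∉X)) (i x x∉X y)

    supports⇒inert : ∀ {X : Pred Var 0ℓ} {a x} → Finite X → Supports _[_∧_] X a →
                     ¬ X x → Inert x a
    supports⇒inert {a = a} {x} (xs , X⊆xs) supp x∉X
      with (z , z∉ , iz) ← inertOutside a (x ∷ xs) =
      fixed⇒inert (z∉ ∘ here)
        (trans (sym (swap-inertʳ x iz)) (supp x z x∉X (z∉ ∘ there ∘ X⊆xs)))

    -- The set { x ∣ ¬ x # a } lives in Set ℓ; supports are required to live in Set.
    supp : Carrier → List Var
    supp a = filter (λ x → em {¬ x # a}) (proj₁ (fs a))

    ∉supp⇒# : ∀ a {x} → x ∉ supp a → x # a
    ∉supp⇒# a x∉ = decidable-stable em λ ¬x# →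
      x∉ (∈-filter⁺ (λ x → em {¬ x # a}) (proj₂ (fs a) ¬x#) ¬x#)

    ∈supp⇒¬# : ∀ a {x} → x ∈ supp a → ¬ x # a
    ∈supp⇒¬# a x∈ = proj₂ (∈-filter⁻ (λ x → em {¬ x # a}) {xs = proj₁ (fs a)} x∈)

    supp-finite : ∀ a → Finite (_∈ supp a)
    supp-finite a = supp a , id

    supp-supports : ∀ a → Supports _[_∧_] (_∈ supp a) a
    supp-supports a = inert-supports λ _ → #⇒inert ∘ ∉supp⇒# a

    -- Minimality: a member of `supp a` outside a finite supporting set would be inert, hence fresh.
    supp-isSupp : ∀ a → IsSupp _[_∧_] (_∈ supp a) a
    supp-isSupp a = supp-finite a , supp-supports a , λ Y finite supports x∈ →
      decidable-stable (lowerEM em) λ x∉Y →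
        ∈supp⇒¬# a x∈ (inert⇒# (supports⇒inert finite supports x∉Y))

    isNominal : IsNominal _[_∧_]
    isNominal = record
      { isPreNominal      = isPreNominal
      ; finitelySupported = λ a → (_∈ supp a) , supp-finite a , supp-supports a
      }

    #⇔freshBySwapping : ∀ x a → x # a ⇔ FreshBySwapping _[_∧_] x a
    #⇔freshBySwapping x a = mk⇔
      (λ x#a → (_∈ supp a) , supp-isSupp a , λ x∈ → ∈supp⇒¬# a x∈ x#a)
      (λ (_ , (finite , supports , _) , x∉X) → inert⇒# (supports⇒inert finite supports x∉X))

mainTheorem4 : ∀ {a} → ExcludedMiddle a →
    (Var : Set) (Var↔ℕ : Var ↔ ℕ) →
    let open WithVariables Var Var↔ℕ in
    (R : Renset a) →
    let open Renset R in
    FiniteSupport →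
    (swap : Carrier → Var → Var → Carrier) →
    DefinesSwapping swap →
    IsNominal swap ×
    (∀ x a → x # a ⇔ FreshBySwapping swap x a)
mainTheorem4 em Var Var↔ℕ R fs swap defines = isNominal , #⇔freshBySwapping
  where
  open RensetProperties em Var Var↔ℕ R
  open Swapping fs swap defines
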